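{- Let $G$ be a graph, $k\ge1$, and suppose $M_k(G)$ is a connected matroid. Then a set $B\subseteq E(G)$ is a base of $M_k(G)$ if and only if $\Delta G\langle B\rangle=k-1$, $V(G\langle B\rangle)=V(G)$, and $G\langle B\rangle$ has no tree component (i.e. $\Delta A\ge0$ for every component $A$ of $G\langle B\rangle$).
   Context: Graphs are finite, may have loops and parallel edges, and have no isolated vertices. $\Delta H=|E(H)|-|V(H)|$. For $X\subseteq E(G)$, $G\langle X\rangle$ is the subgraph with edge set $X$ and vertex set the vertices incident to $X$. For $k\ge0$, $M_k(G)$ is the matroid on $E(G)$ whose circuits are the inclusion-minimal members of $\{C\subseteq E(G):C\neq\emptyset,\ |C|=|V(G\langle C\rangle)|+k\}$. A matroid is connected if its ground set has at least two elements and every two elements lie in a common circuit. -}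

module Defs where

open import Data.Bool using (true; false)
open import Data.Empty using (⊥-elim)
open import Data.Fin using (Fin)
open import Data.Fin.Properties using (any?) renaming (_≟_ to _≟ᶠ_)
open import Data.Fin.Subset
open import Data.Fin.Subset.Properties
open import Data.Integer as ℤ using (ℤ; 0ℤ)
open import Data.Nat using (ℕ; suc; _+_; _≤_; _<_; s≤s; s≤s⁻¹; _≟_; _≤?_)
open import Data.Nat.Induction using (<-wellFounded)
open import Data.Nat.Properties
  using (+-suc; +-comm; ≤-trans; ≤-reflexive; ≤∧≢⇒<; m≤m+n;
         +-mono-≤; +-monoˡ-≤; +-monoʳ-≤; +-cancelʳ-≤; ≰⇒>; module ≤-Reasoning)
open import Data.Nat.Tactic.RingSolver using (solve-∀)
open import Data.Product using (_×_; _,_; proj₁; proj₂; ∃-syntax)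
open import Data.Sum using (_⊎_; inj₁; inj₂)
open import Data.Vec using ([]; _∷_; tabulate)
open import Data.Vec.Properties using (lookup∘tabulate; []=⇒lookup; lookup⇒[]=)
open import Induction.WellFounded using (Acc; acc)
open import Relation.Binary.Construct.Closure.ReflexiveTransitive using (Star)
open import Relation.Binary.PropositionalEquality
  using (_≡_; _≢_; refl; sym; trans; cong; subst)
open import Relation.Nullary using (¬_; Dec; does; yes; no)
open import Relation.Nullary.Decidable using (_×-dec_; _⊎-dec_; ¬?; dec-true)

------------------------------------------------------------------------
-- Graphs

-- The order of the two ends of an edge carries no meaning.  A loop has
-- equal ends; parallel edges have the same ends.
record Graph : Set where
  field
    #V         : ℕ
    #E         : ℕ
    ends       : Fin #E → Fin #V × Fin #V
    noIsolated : ∀ v → ∃[ e ] (v ≡ proj₁ (ends e) ⊎ v ≡ proj₂ (ends e))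

open Graph public

Incident : (G : Graph) → Fin (#V G) → Fin (#E G) → Set
Incident G v e = v ≡ proj₁ (ends G e) ⊎ v ≡ proj₂ (ends G e)

record Subgraph (G : Graph) : Set where
  field
    V      : Subset (#V G)
    E      : Subset (#E G)
    closed : ∀ {v e} → e ∈ E → Incident G v e → v ∈ V

open Subgraph public

Δ : {G : Graph} → Subgraph G → ℤ
Δ H = ℤ.+ ∣ E H ∣ ℤ.- ℤ.+ ∣ V H ∣

_⊑_ : {G : Graph} → Subgraph G → Subgraph G → Set
A ⊑ H = V A ⊆ V H × E A ⊆ E H

Adjacent : {G : Graph} → Subgraph G → Fin (#V G) → Fin (#V G) → Set
Adjacent {G} A u v =
  ∃[ e ] (e ∈ E A × (ends G e ≡ (u , v) ⊎ ends G e ≡ (v , u)))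

ConnectedSubgraph : {G : Graph} → Subgraph G → Set
ConnectedSubgraph A =
  Nonempty (V A) × (∀ {u v} → u ∈ V A → v ∈ V A → Star (Adjacent A) u v)

-- Components are the inclusion-maximal connected subgraphs.
Component : {G : Graph} → Subgraph G → Subgraph G → Set
Component {G} H A =
  A ⊑ H × ConnectedSubgraph A ×
  (∀ (A′ : Subgraph G) → A′ ⊑ H → ConnectedSubgraph A′ → A ⊑ A′ → A′ ⊑ A)

-- A connected graph A satisfies Δ A ≥ -1, with equality exactly for trees.
NoTreeComponent : {G : Graph} → Subgraph G → Set
NoTreeComponent H = ∀ A → Component H A → 0ℤ ℤ.≤ Δ A

------------------------------------------------------------------------
-- The subgraph G ⟨ X ⟩

touched? : (G : Graph) (X : Subset (#E G)) (v : Fin (#V G)) →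
           Dec (∃[ e ] (e ∈ X × Incident G v e))
touched? G X v = any? λ e →
  (e ∈? X) ×-dec
  ((v ≟ᶠ proj₁ (ends G e)) ⊎-dec (v ≟ᶠ proj₂ (ends G e)))

touched : (G : Graph) → Subset (#E G) → Subset (#V G)
touched G X = tabulate λ v → does (touched? G X v)

∈-touched⁺ : ∀ G X {v e} → e ∈ X → Incident G v e → v ∈ touched G X
∈-touched⁺ G X {v} {e} e∈X inc = lookup⇒[]= v _
  (trans (lookup∘tabulate _ v) (dec-true (touched? G X v) (e , e∈X , inc)))

∈-touched⁻ : ∀ G X {v} → v ∈ touched G X → ∃[ e ] (e ∈ X × Incident G v e)
∈-touched⁻ G X {v} v∈ with touched? G X v
                         | trans (sym (lookup∘tabulate (λ u → does (touched? G X u)) v))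
                                 ([]=⇒lookup v∈)
... | yes w | _  = w
... | no _  | ()

_⟨_⟩ : (G : Graph) → Subset (#E G) → Subgraph G
G ⟨ X ⟩ = record { V = touched G X ; E = X ; closed = ∈-touched⁺ G X }

------------------------------------------------------------------------
-- Matroids on Fin m, given by their circuits

record Matroid (m : ℕ) : Set₁ where
  field
    Circuit     : Subset m → Set
    nonempty    : ∀ {C} → Circuit C → Nonempty C
    clutter     : ∀ {C D} → Circuit C → Circuit D → C ⊆ D → C ≡ D
    elimination : ∀ {C D e} → Circuit C → Circuit D → C ≢ D → e ∈ C → e ∈ D →
                  ∃[ Z ] (Circuit Z × Z ⊆ (C ∪ D) - e)

  Independent : Subset m → Set
  Independent I = ∀ C → Circuit C → C ⊈ I

  Base : Subset m → Set
  Base B = Independent B × (∀ I → Independent I → B ⊆ I → I ≡ B)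

  Connected : Set
  Connected =
    2 ≤ m × (∀ e f → e ≢ f → ∃[ C ] (Circuit C × e ∈ C × f ∈ C))

open Matroid public using (Base; Connected)

------------------------------------------------------------------------
-- The circuits of M k G

Candidate : (k : ℕ) (G : Graph) → Subset (#E G) → Set
Candidate k G C = Nonempty C × ∣ C ∣ ≡ ∣ V (G ⟨ C ⟩) ∣ + k

IsCircuit : (k : ℕ) (G : Graph) → Subset (#E G) → Set
IsCircuit k G C = Candidate k G C × (∀ D → Candidate k G D → D ⊆ C → D ≡ C)

------------------------------------------------------------------------
-- The circuit axioms for M k G

∣∪∣+∣∩∣ : ∀ {n} (p q : Subset n) → ∣ p ∪ q ∣ + ∣ p ∩ q ∣ ≡ ∣ p ∣ + ∣ q ∣
∣∪∣+∣∩∣ []          []          = refl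
∣∪∣+∣∩∣ (true  ∷ p) (true  ∷ q) =
  cong suc (trans (+-suc _ _) (trans (cong suc (∣∪∣+∣∩∣ p q)) (sym (+-suc _ _))))
∣∪∣+∣∩∣ (true  ∷ p) (false ∷ q) = cong suc (∣∪∣+∣∩∣ p q)
∣∪∣+∣∩∣ (false ∷ p) (true  ∷ q) =
  trans (cong suc (∣∪∣+∣∩∣ p q)) (sym (+-suc _ _))
∣∪∣+∣∩∣ (false ∷ p) (false ∷ q) = ∣∪∣+∣∩∣ p q

∣p∣≤1+∣p-x∣ : ∀ {n} (p : Subset n) x → ∣ p ∣ ≤ suc ∣ p - x ∣
∣p∣≤1+∣p-x∣ p x = begin
  ∣ p ∣                                        ≤⟨ p⊆q⇒∣p∣≤∣q∣ cover ⟩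
  ∣ (p - x) ∪ ⁅ x ⁆ ∣                          ≤⟨ m≤m+n _ _ ⟩
  ∣ (p - x) ∪ ⁅ x ⁆ ∣ + ∣ (p - x) ∩ ⁅ x ⁆ ∣    ≡⟨ ∣∪∣+∣∩∣ (p - x) ⁅ x ⁆ ⟩
  ∣ p - x ∣ + ∣ ⁅ x ⁆ ∣                        ≡⟨ cong (∣ p - x ∣ +_) (∣⁅x⁆∣≡1 x) ⟩
  ∣ p - x ∣ + 1                                ≡⟨ +-comm _ 1 ⟩
  suc ∣ p - x ∣                                ∎
  where
  open ≤-Reasoning
  cover : p ⊆ (p - x) ∪ ⁅ x ⁆
  cover {y} y∈p with y ≟ᶠ x
  ... | yes refl = x∈p∪q⁺ (inj₂ (x∈⁅x⁆ x))
  ... | no  y≢x  = x∈p∪q⁺ (inj₁ (x∈p∧x≢y⇒x∈p-y y∈p y≢x))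

Nonempty⇒1≤∣p∣ : ∀ {n} {p : Subset n} → Nonempty p → 1 ≤ ∣ p ∣
Nonempty⇒1≤∣p∣ {p = p} (x , x∈p) =
  subst (_≤ ∣ p ∣) (∣⁅x⁆∣≡1 x) (p⊆q⇒∣p∣≤∣q∣ λ y∈ → subst (_∈ p) (sym (x∈⁅y⁆⇒x≡y x y∈)) x∈p)

1≤∣p∣⇒Nonempty : ∀ {n} {p : Subset n} → 1 ≤ ∣ p ∣ → Nonempty p
1≤∣p∣⇒Nonempty {n} {p} 1≤ with nonempty? p
... | yes ne = ne
... | no  ¬ne with subst (1 ≤_) (trans (cong ∣_∣ (Empty-unique ¬ne)) (∣⊥∣≡0 n)) 1≤
...   | ()

module _ (k : ℕ) (G : Graph) where

  private
    T : Subset (#E G) → Subset (#V G)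
    T = touched G

  touched-mono : ∀ {X Y} → X ⊆ Y → T X ⊆ T Y
  touched-mono {X} {Y} X⊆Y v∈ with ∈-touched⁻ G X v∈
  ... | e , e∈X , inc = ∈-touched⁺ G Y (X⊆Y e∈X) inc

  touched-∪ : ∀ X Y → T (X ∪ Y) ⊆ T X ∪ T Y
  touched-∪ X Y v∈ with ∈-touched⁻ G (X ∪ Y) v∈
  ... | e , e∈ , inc with x∈p∪q⁻ X Y e∈
  ...   | inj₁ e∈X = x∈p∪q⁺ (inj₁ (∈-touched⁺ G X e∈X inc))
  ...   | inj₂ e∈Y = x∈p∪q⁺ (inj₂ (∈-touched⁺ G Y e∈Y inc))

  touched-∩ : ∀ X Y → T (X ∩ Y) ⊆ T X ∩ T Y
  touched-∩ X Y v∈ =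
    x∈p∩q⁺ (touched-mono (p∩q⊆p X Y) v∈ , touched-mono (p∩q⊆q X Y) v∈)

  touched-nonempty : ∀ {X} → Nonempty X → Nonempty (T X)
  touched-nonempty {X} (e , e∈X) = _ , ∈-touched⁺ G X e∈X (inj₁ refl)

  Dense : Subset (#E G) → Set
  Dense X = Nonempty X × ∣ T X ∣ + k ≤ ∣ X ∣

  dense? : ∀ X → Dec (Dense X)
  dense? X = nonempty? X ×-dec (∣ T X ∣ + k ≤? ∣ X ∣)

  dense-remove : ∀ {X} e → Nonempty X → ∣ T X ∣ + k < ∣ X ∣ → Dense (X - e)
  dense-remove {X} e ne lt = 1≤∣p∣⇒Nonempty 1≤ , ≤-trans (+-monoˡ-≤ k mono) bound
    where
    bound : ∣ T X ∣ + k ≤ ∣ X - e ∣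
    bound = s≤s⁻¹ (≤-trans lt (∣p∣≤1+∣p-x∣ X e))
    mono : ∣ T (X - e) ∣ ≤ ∣ T X ∣
    mono = p⊆q⇒∣p∣≤∣q∣ (touched-mono (p─q⊆p X ⁅ e ⁆))
    1≤ : 1 ≤ ∣ X - e ∣
    1≤ = ≤-trans (Nonempty⇒1≤∣p∣ (touched-nonempty ne)) (≤-trans (m≤m+n _ k) bound)

  candidate⇒dense : ∀ {X} → Candidate k G X → Dense X
  candidate⇒dense (ne , eq) = ne , ≤-reflexive (sym eq)

  dense⇒circuit : ∀ X → Dense X → ∃[ C ] (IsCircuit k G C × C ⊆ X)
  dense⇒circuit X = go X (<-wellFounded ∣ X ∣)
    where
    go : ∀ X → Acc _<_ ∣ X ∣ → Dense X → ∃[ C ] (IsCircuit k G C × C ⊆ X)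
    go X (acc rec) dX with anySubset? (λ D → (D ⊂? X) ×-dec dense? D)
    ... | yes (D , D⊂X , dD) with go D (rec (p⊂q⇒∣p∣<∣q∣ D⊂X)) dD
    ...   | C , circ , C⊆D = C , circ , λ x∈ → p⊂q⇒p⊆q D⊂X (C⊆D x∈)
    go X (acc rec) (ne@(e , e∈X) , le) | no ¬smaller =
      X , ((ne , size) , minimal) , λ x∈ → x∈
      where
      size : ∣ X ∣ ≡ ∣ T X ∣ + k
      size with ∣ X ∣ ≟ ∣ T X ∣ + k
      ... | yes eq = eq
      ... | no  ≢  = ⊥-elim (¬smaller
        (X - e , x∈p⇒p-x⊂p e∈X ,
         dense-remove e ne (≤∧≢⇒< le (λ eq → ≢ (sym eq)))))
      minimal : ∀ D → Candidate k G D → D ⊆ X → D ≡ X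
      minimal D cD D⊆X with X ⊆? D
      ... | yes X⊆D = ⊆-antisym D⊆X X⊆D
      ... | no  X⊈D with any? (λ x → (x ∈? X) ×-dec ¬? (x ∈? D))
      ...   | yes w  = ⊥-elim (¬smaller (D , (D⊆X , w) , candidate⇒dense cD))
      ...   | no  ¬w = ⊥-elim (X⊈D X⊆D)
        where
        X⊆D : X ⊆ D
        X⊆D {x} x∈X with x ∈? D
        ... | yes x∈D = x∈D
        ... | no  x∉D = ⊥-elim (¬w (x , x∈X , x∉D))

  circuit-clutter : ∀ {C D} → IsCircuit k G C → IsCircuit k G D → C ⊆ D → C ≡ D
  circuit-clutter (candC , _) (_ , minD) = minD _ candC

  -- X ↦ ∣ X ∣ - ∣ T X ∣ is supermodular, and it is less than k on the
  -- nonempty set C ∩ D, so it is greater than k on C ∪ D.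
  circuit-elimination :
    ∀ {C D e} → IsCircuit k G C → IsCircuit k G D → C ≢ D → e ∈ C → e ∈ D →
    ∃[ Z ] (IsCircuit k G Z × Z ⊆ (C ∪ D) - e)
  circuit-elimination {C} {D} {e} cC@((_ , sizeC) , _) cD@((_ , sizeD) , _) C≢D e∈C e∈D =
    dense⇒circuit ((C ∪ D) - e) (dense-remove e (e , x∈p∪q⁺ (inj₁ e∈C)) lt)
    where
    open ≤-Reasoning

    sparse : ¬ (∣ T (C ∩ D) ∣ + k ≤ ∣ C ∩ D ∣)
    sparse le with dense⇒circuit (C ∩ D) ((e , x∈p∩q⁺ (e∈C , e∈D)) , le)
    ... | Z , cZ , Z⊆ = C≢D (trans
      (sym (circuit-clutter cZ cC λ x∈ → p∩q⊆p C D (Z⊆ x∈)))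
      (circuit-clutter cZ cD λ x∈ → p∩q⊆q C D (Z⊆ x∈)))

    rearrange₁ : ∀ u i k → suc (u + k) + (i + k) ≡ suc ((u + i) + (k + k))
    rearrange₁ = solve-∀

    rearrange₂ : ∀ c d k → (c + d) + (k + k) ≡ (c + k) + (d + k)
    rearrange₂ = solve-∀

    total : suc (∣ T (C ∪ D) ∣ + k) + (∣ T (C ∩ D) ∣ + k) ≤ ∣ C ∪ D ∣ + (∣ T (C ∩ D) ∣ + k)
    total = begin
      suc (∣ T (C ∪ D) ∣ + k) + (∣ T (C ∩ D) ∣ + k)
        ≡⟨ rearrange₁ (∣ T (C ∪ D) ∣) (∣ T (C ∩ D) ∣) k ⟩
      suc ((∣ T (C ∪ D) ∣ + ∣ T (C ∩ D) ∣) + (k + k))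
        ≤⟨ s≤s (+-monoˡ-≤ (k + k) (+-mono-≤ (p⊆q⇒∣p∣≤∣q∣ (touched-∪ C D))
                                            (p⊆q⇒∣p∣≤∣q∣ (touched-∩ C D)))) ⟩
      suc ((∣ T C ∪ T D ∣ + ∣ T C ∩ T D ∣) + (k + k))
        ≡⟨ cong (λ s → suc (s + (k + k))) (∣∪∣+∣∩∣ (T C) (T D)) ⟩
      suc ((∣ T C ∣ + ∣ T D ∣) + (k + k))
        ≡⟨ cong suc (rearrange₂ (∣ T C ∣) (∣ T D ∣) k) ⟩
      suc ((∣ T C ∣ + k) + (∣ T D ∣ + k))
        ≡⟨ cong (λ s → suc (s + (∣ T D ∣ + k))) sizeC ⟨
      suc (∣ C ∣ + (∣ T D ∣ + k))
        ≡⟨ cong (λ s → suc (∣ C ∣ + s)) sizeD ⟨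
      suc (∣ C ∣ + ∣ D ∣)
        ≡⟨ cong suc (∣∪∣+∣∩∣ C D) ⟨
      suc (∣ C ∪ D ∣ + ∣ C ∩ D ∣)
        ≡⟨ +-suc _ _ ⟨
      ∣ C ∪ D ∣ + suc ∣ C ∩ D ∣
        ≤⟨ +-monoʳ-≤ (∣ C ∪ D ∣) (≰⇒> sparse) ⟩
      ∣ C ∪ D ∣ + (∣ T (C ∩ D) ∣ + k)
        ∎

    lt : ∣ T (C ∪ D) ∣ + k < ∣ C ∪ D ∣
    lt = +-cancelʳ-≤ (∣ T (C ∩ D) ∣ + k) _ _ total

M : (k : ℕ) (G : Graph) → Matroid (#E G)
M k G = record
  { Circuit     = IsCircuit k G
  ; nonempty    = λ c → proj₁ (proj₁ c)
  ; clutter     = circuit-clutter k G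
  ; elimination = circuit-elimination k G
  }

{-# OPTIONS --safe #-}

-- Write t X for the number of vertices touched by X and k = j + 1.  A set is
-- independent iff every subset X has |X| ≤ t X + j; call X tight if |X| ≥ t X + j.
--
-- Let B be a base.  As t is submodular and j ≥ 0, the union of two tight subsets
-- of B is tight, even when they are disjoint; so there is a largest tight Z ⊆ B.
-- For e ∉ B the circuit in B + e minus e is tight, hence e has its ends in T Z.
-- A circuit through some g ∈ B \ Z and some e ∉ B would, by submodularity, lose
-- no excess |X| - t X when restricted to Z ∪ (E \ B), contradicting minimality.
-- So Z = B.  Deleting a tree component from B would leave a dense set.
--
-- Conversely, if B has no tree component then a dense subset of B stays dense
-- when an edge of B meeting it, or a component of B disjoint from it, is added.
-- So a dependent B would itself be dense, against Δ B = j.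
module Submission where

open import Defs
open import Data.Empty using (⊥-elim)
open import Data.Fin using (Fin)
open import Data.Fin.Properties using (any?) renaming (_≟_ to _≟ᶠ_)
open import Data.Fin.Subset using (Subset; ⊤; ∣_∣; _∈_; _∉_; _⊆_; _⊂_; _∪_; _∩_; ∁; ⁅_⁆)
open import Data.Fin.Subset.Properties
import Data.Integer as ℤ
import Data.Integer.Properties as ℤ
open import Data.Nat using (ℕ; suc; _+_; _≤_; _<_; s≤s; z≤n; s≤s⁻¹; _≤?_)
open import Data.Nat.Induction using (<-wellFounded)
open import Data.Nat.Properties
open import Data.Nat.Tactic.RingSolver using (solve-∀)
open import Data.Product using (_×_; _,_; proj₁; proj₂; ∃-syntax)
open import Data.Sum using (_⊎_; inj₁; inj₂; [_,_]′)
open import Function.Base using (_∘_)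
open import Function.Bundles using (_⇔_; mk⇔)
open import Induction.WellFounded using (Acc; acc)
open import Relation.Binary.Construct.Closure.ReflexiveTransitive as Star using (Star; ε; _◅_; _◅◅_)
open import Relation.Binary.PropositionalEquality
  using (_≡_; _≢_; refl; sym; trans; cong; subst; module ≡-Reasoning)
open import Relation.Nullary using (Dec; yes; no)
open import Relation.Nullary.Decidable using (_×-dec_; _⊎-dec_; ¬?)

open Matroid using (Independent)

-- Finite subsets

module _ {n : ℕ} where

  ⁅⁆⊆ : ∀ {x : Fin n} {p} → x ∈ p → ⁅ x ⁆ ⊆ p
  ⁅⁆⊆ {x} {p} x∈p y∈ = subst (_∈ p) (sym (x∈⁅y⁆⇒x≡y x y∈)) x∈p

  ∪-lub : ∀ {p q r : Subset n} → p ⊆ r → q ⊆ r → p ∪ q ⊆ r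
  ∪-lub {p} {q} p⊆r q⊆r = [ p⊆r , q⊆r ]′ ∘ x∈p∪q⁻ p q

  ⊆∪⁅⁆∖ : ∀ {p q : Subset n} {x} → p ⊆ q ∪ ⁅ x ⁆ → x ∉ p → p ⊆ q
  ⊆∪⁅⁆∖ {p} {q} {x} p⊆ x∉p {y} y∈p with x∈p∪q⁻ q ⁅ x ⁆ (p⊆ y∈p)
  ... | inj₁ y∈q = y∈q
  ... | inj₂ y∈x = ⊥-elim (x∉p (subst (_∈ p) (x∈⁅y⁆⇒x≡y x y∈x) y∈p))

  ⊂-∪⁅⁆ : ∀ {p : Subset n} {x} → x ∉ p → p ⊂ p ∪ ⁅ x ⁆
  ⊂-∪⁅⁆ {p} {x} x∉p = p⊆p∪q ⁅ x ⁆ , x , q⊆p∪q p ⁅ x ⁆ (x∈⁅x⁆ x) , x∉p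

  ⊆-or-witness : ∀ (p q : Subset n) → p ⊆ q ⊎ ∃[ x ] (x ∈ p × x ∉ q)
  ⊆-or-witness p q with any? (λ x → (x ∈? p) ×-dec ¬? (x ∈? q))
  ... | yes w = inj₂ w
  ... | no ¬w = inj₁ p⊆q
    where
    p⊆q : p ⊆ q
    p⊆q {x} x∈p with x ∈? q
    ... | yes x∈q = x∈q
    ... | no  x∉q = ⊥-elim (¬w (x , x∈p , x∉q))

  p⊆q∧∣q∣≤∣p∣⇒q⊆p : ∀ {p q : Subset n} → p ⊆ q → ∣ q ∣ ≤ ∣ p ∣ → q ⊆ p
  p⊆q∧∣q∣≤∣p∣⇒q⊆p {p} {q} p⊆q le with ⊆-or-witness q p
  ... | inj₁ q⊆p = q⊆p
  ... | inj₂ w   = ⊥-elim (<⇒≱ (p⊂q⇒∣p∣<∣q∣ (p⊆q , w)) le)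

  ∣∪∣≤∣∣+∣∣ : ∀ (p q : Subset n) → ∣ p ∪ q ∣ ≤ ∣ p ∣ + ∣ q ∣
  ∣∪∣≤∣∣+∣∣ p q = ≤-trans (m≤m+n _ _) (≤-reflexive (∣∪∣+∣∩∣ p q))

  disjoint⇒∣∪∣≡∣∣+∣∣ : ∀ {p q : Subset n} → (∀ {x} → x ∈ p → x ∉ q) → ∣ p ∪ q ∣ ≡ ∣ p ∣ + ∣ q ∣
  disjoint⇒∣∪∣≡∣∣+∣∣ {p} {q} p#q = trans (sym (+-identityʳ _))
    (trans (cong (λ s → ∣ p ∪ q ∣ + s) (sym ∣∩∣≡0)) (∣∪∣+∣∩∣ p q))
    where
    ∣∩∣≡0 : ∣ p ∩ q ∣ ≡ 0
    ∣∩∣≡0 = trans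
      (cong ∣_∣ (Empty-unique λ (x , x∈) → let x∈p , x∈q = x∈p∩q⁻ p q x∈ in p#q x∈p x∈q))
      (∣⊥∣≡0 n)

  ∣p∣≤∣p∩q∣+∣p∩∁q∣ : ∀ (p q : Subset n) → ∣ p ∣ ≤ ∣ p ∩ q ∣ + ∣ p ∩ ∁ q ∣
  ∣p∣≤∣p∩q∣+∣p∩∁q∣ p q = ≤-trans (p⊆q⇒∣p∣≤∣q∣ cover) (∣∪∣≤∣∣+∣∣ (p ∩ q) (p ∩ ∁ q))
    where
    cover : p ⊆ (p ∩ q) ∪ (p ∩ ∁ q)
    cover {x} x∈p with x ∈? q
    ... | yes x∈q = x∈p∪q⁺ (inj₁ (x∈p∩q⁺ (x∈p , x∈q)))
    ... | no  x∉q = x∈p∪q⁺ (inj₂ (x∈p∩q⁺ (x∈p , x∉p⇒x∈∁p x∉q)))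

  -- Each enlargement shrinks the complement, so the process stops, and it can stop only at a set
  -- with `Q`. Components, maximal tight sets and dense sets are all grown this way.
  ascend : ∀ {P Q : Subset n → Set} →
           (∀ X → P X → Q X ⊎ ∃[ Y ] (X ⊂ Y × P Y)) →
           ∀ X → P X → ∃[ Z ] (P Z × Q Z)
  ascend {P} {Q} step X = go X (<-wellFounded ∣ ∁ X ∣)
    where
    go : ∀ X → Acc _<_ ∣ ∁ X ∣ → P X → ∃[ Z ] (P Z × Q Z)
    go X (acc rec) pX with step X pX
    ... | inj₁ qX             = X , pX , qX
    ... | inj₂ (Y , X⊂Y , pY) = go Y (rec (p⊂q⇒∣p∣<∣q∣ (p⊂q⇒∁p⊃∁q X⊂Y))) pY

  maximal : ∀ {P : Subset n → Set} → (∀ X → Dec (P X)) →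
            ∀ X → P X → ∃[ Z ] (P Z × (∀ Y → P Y → Z ⊆ Y → Y ⊆ Z))
  maximal {P} P? = ascend step
    where
    step : ∀ X → P X → (∀ Y → P Y → X ⊆ Y → Y ⊆ X) ⊎ ∃[ Y ] (X ⊂ Y × P Y)
    step X pX with anySubset? (λ Y → (X ⊂? Y) ×-dec P? Y)
    ... | yes w = inj₂ w
    ... | no ¬w = inj₁ λ Y pY X⊆Y →
      [ (λ Y⊆X → Y⊆X) , (λ w → ⊥-elim (¬w (Y , (X⊆Y , w) , pY))) ]′ (⊆-or-witness Y X)

-- Touched vertices

module _ (G : Graph) where

  private
    T : Subset (#E G) → Subset (#V G)
    T = touched G

    t : Subset (#E G) → ℕ
    t X = ∣ T X ∣

  incident? : ∀ v e → Dec (Incident G v e)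
  incident? v e = (v ≟ᶠ proj₁ (ends G e)) ⊎-dec (v ≟ᶠ proj₂ (ends G e))

  T-mono : ∀ {X Y} → X ⊆ Y → T X ⊆ T Y
  T-mono = touched-mono 0 G

  t-mono : ∀ {X Y} → X ⊆ Y → t X ≤ t Y
  t-mono X⊆Y = p⊆q⇒∣p∣≤∣q∣ (T-mono X⊆Y)

  -- Cardinality is modular on vertex sets; the loss comes from the intersection, as a vertex
  -- touched by both sets need not be touched by a common edge.
  t-submodular : ∀ X Y → t (X ∪ Y) + t (X ∩ Y) ≤ t X + t Y
  t-submodular X Y = ≤-trans
    (+-mono-≤ (p⊆q⇒∣p∣≤∣q∣ (touched-∪ 0 G X Y)) (p⊆q⇒∣p∣≤∣q∣ (touched-∩ 0 G X Y)))
    (≤-reflexive (∣∪∣+∣∩∣ (T X) (T Y)))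

  t-∪ : ∀ X Y → t (X ∪ Y) ≤ t X + t Y
  t-∪ X Y = ≤-trans (m≤m+n _ _) (t-submodular X Y)

  ∈T⁅⁆⁻ : ∀ {v e} → v ∈ T ⁅ e ⁆ → Incident G v e
  ∈T⁅⁆⁻ {v} {e} v∈ with ∈-touched⁻ G ⁅ e ⁆ v∈
  ... | f , f∈ , inc = subst (Incident G v) (x∈⁅y⁆⇒x≡y e f∈) inc

  -- Connectedness

  adjacent-ends : ∀ {A : Subgraph G} {u v} ((e , _) : Adjacent A u v) →
                  Incident G u e × Incident G v e
  adjacent-ends (_ , _ , inj₁ eq) = inj₁ (sym (cong proj₁ eq)) , inj₂ (sym (cong proj₂ eq))
  adjacent-ends (_ , _ , inj₂ eq) = inj₂ (sym (cong proj₂ eq)) , inj₁ (sym (cong proj₁ eq))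

  adjacent-mono : ∀ {A H : Subgraph G} → E A ⊆ E H → ∀ {u v} → Adjacent A u v → Adjacent H u v
  adjacent-mono A⊆H (e , e∈A , eq) = e , A⊆H e∈A , eq

  ends-joined : ∀ {H : Subgraph G} {e u v} → e ∈ E H → Incident G u e → Incident G v e →
                Star (Adjacent H) u v
  ends-joined e∈ (inj₁ refl) (inj₁ refl) = ε
  ends-joined e∈ (inj₁ refl) (inj₂ refl) = (_ , e∈ , inj₁ refl) ◅ ε
  ends-joined e∈ (inj₂ refl) (inj₁ refl) = (_ , e∈ , inj₂ refl) ◅ ε
  ends-joined e∈ (inj₂ refl) (inj₂ refl) = ε

  -- Every walk is routed through `v`, where `e` meets `A`. Arbitrary subgraphs are allowed because
  -- `component-closed` attaches an edge to a component that is not given in the form `G ⟨ X ⟩`.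
  connected-attach : ∀ {A H : Subgraph G} {e v} → ConnectedSubgraph A →
    V A ⊆ V H → E A ⊆ E H → e ∈ E H → v ∈ V A → Incident G v e →
    (∀ {u} → u ∈ V H → u ∈ V A ⊎ Incident G u e) → ConnectedSubgraph H
  connected-attach {A} {H} {e} {v} (_ , walk) VA⊆ EA⊆ e∈ v∈ v∼e cover =
    (v , VA⊆ v∈) , λ x∈ y∈ → to-v (cover x∈) ◅◅ from-v (cover y∈)
    where
    lift : ∀ {x y} → Star (Adjacent A) x y → Star (Adjacent H) x y
    lift = Star.map (adjacent-mono {A} {H} EA⊆)

    to-v : ∀ {x} → x ∈ V A ⊎ Incident G x e → Star (Adjacent H) x v
    to-v (inj₁ x∈)  = lift (walk x∈ v∈)
    to-v (inj₂ x∼e) = ends-joined {H} e∈ x∼e v∼e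

    from-v : ∀ {y} → y ∈ V A ⊎ Incident G y e → Star (Adjacent H) v y
    from-v (inj₁ y∈)  = lift (walk v∈ y∈)
    from-v (inj₂ y∼e) = ends-joined {H} e∈ v∼e y∼e

  -- For `X ⊆ B` these are the edge sets of unions of components of `G ⟨ B ⟩`.
  ClosedIn : Subset (#E G) → Subset (#E G) → Set
  ClosedIn B X = ∀ {e v} → e ∈ B → Incident G v e → v ∈ T X → e ∈ X

  closed-or-attached : ∀ B X → ClosedIn B X ⊎
    ∃[ e ] (e ∈ B × e ∉ X × ∃[ v ] (v ∈ T X × Incident G v e))
  closed-or-attached B X
    with any? (λ e → (e ∈? B) ×-dec ¬? (e ∈? X) ×-dec
                     any? (λ v → (v ∈? T X) ×-dec incident? v e))
  ... | yes w = inj₂ w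
  ... | no ¬w = inj₁ closedX
    where
    closedX : ClosedIn B X
    closedX {e} {v} e∈B v∼e v∈ with e ∈? X
    ... | yes e∈X = e∈X
    ... | no  e∉X = ⊥-elim (¬w (e , e∈B , e∉X , v , v∈ , v∼e))

  walk-closed : ∀ {A : Subgraph G} {B X} → ClosedIn B X → E A ⊆ B →
                ∀ {u w} → Star (Adjacent A) u w → u ∈ T X → w ∈ T X
  walk-closed closedX A⊆B ε u∈ = u∈
  walk-closed {A} {X = X} closedX A⊆B (adj@(_ , e∈ , _) ◅ rest) u∈ =
    let u∼e , w∼e = adjacent-ends {A} adj
    in walk-closed {A} closedX A⊆B rest (∈-touched⁺ G X (closedX (A⊆B e∈) u∼e u∈) w∼e)

  -- Walks from `r` cannot leave `T X`, so a connected subgraph of `G ⟨ B ⟩` containing `G ⟨ X ⟩`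
  -- gains no vertex, and closedness then leaves it no new edge.
  closed-connected⇒component : ∀ {B X} → X ⊆ B → ConnectedSubgraph (G ⟨ X ⟩) → ClosedIn B X →
                               Component (G ⟨ B ⟩) (G ⟨ X ⟩)
  closed-connected⇒component {B} {X} X⊆B conX@((r , r∈) , _) closedX =
    (T-mono X⊆B , X⊆B) , conX , maximalX
    where
    maximalX : ∀ A → A ⊑ (G ⟨ B ⟩) → ConnectedSubgraph A → (G ⟨ X ⟩) ⊑ A → A ⊑ (G ⟨ X ⟩)
    maximalX A (_ , EA⊆B) (_ , walk) (TX⊆ , _) = VA⊆ , λ e∈ →
      closedX (EA⊆B e∈) (inj₁ refl) (VA⊆ (closed A e∈ (inj₁ refl)))
      where
      VA⊆ : V A ⊆ T X
      VA⊆ w∈ = walk-closed {A} closedX EA⊆B (walk (TX⊆ r∈) w∈) r∈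

  -- The component is grown from `e` alone, one attached edge at a time, until it is closed.
  component-of-edge : ∀ {B e} → e ∈ B →
    ∃[ X ] (e ∈ X × X ⊆ B × Component (G ⟨ B ⟩) (G ⟨ X ⟩))
  component-of-edge {B} {e} e∈B =
    let X , (e∈X , X⊆B , con) , closedX = ascend step ⁅ e ⁆ (x∈⁅x⁆ e , ⁅⁆⊆ e∈B , con₀)
    in X , e∈X , X⊆B , closed-connected⇒component X⊆B con closedX
    where
    P : Subset (#E G) → Set
    P X = e ∈ X × X ⊆ B × ConnectedSubgraph (G ⟨ X ⟩)

    con₀ : ConnectedSubgraph (G ⟨ ⁅ e ⁆ ⟩)
    con₀ = touched-nonempty 0 G (e , x∈⁅x⁆ e) , λ u∈ v∈ →
      ends-joined {G ⟨ ⁅ e ⁆ ⟩} (x∈⁅x⁆ e) (∈T⁅⁆⁻ u∈) (∈T⁅⁆⁻ v∈)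

    step : ∀ X → P X → ClosedIn B X ⊎ ∃[ Y ] (X ⊂ Y × P Y)
    step X (e∈X , X⊆B , con) with closed-or-attached B X
    ... | inj₁ closedX = inj₁ closedX
    ... | inj₂ (f , f∈B , f∉X , v , v∈ , v∼f) =
      inj₂ (X ∪ ⁅ f ⁆ , ⊂-∪⁅⁆ f∉X , X⊆ e∈X , ∪-lub X⊆B (⁅⁆⊆ f∈B) , con′)
      where
      X⊆ : X ⊆ X ∪ ⁅ f ⁆
      X⊆ = p⊆p∪q ⁅ f ⁆

      cover : ∀ {u} → u ∈ T (X ∪ ⁅ f ⁆) → u ∈ T X ⊎ Incident G u f
      cover u∈ with x∈p∪q⁻ (T X) (T ⁅ f ⁆) (touched-∪ 0 G X ⁅ f ⁆ u∈)
      ... | inj₁ u∈X = inj₁ u∈X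
      ... | inj₂ u∈f = inj₂ (∈T⁅⁆⁻ u∈f)

      con′ : ConnectedSubgraph (G ⟨ X ∪ ⁅ f ⁆ ⟩)
      con′ = connected-attach {G ⟨ X ⟩} {G ⟨ X ∪ ⁅ f ⁆ ⟩} con
        (T-mono X⊆) X⊆ (q⊆p∪q X ⁅ f ⁆ (x∈⁅x⁆ f)) v∈ v∼f cover

  -- Otherwise attaching `e` would give a larger connected subgraph, contrary to the maximality of
  -- `A`.
  component-closed : ∀ {B A} → Component (G ⟨ B ⟩) A →
                     ∀ {e v} → e ∈ B → Incident G v e → v ∈ V A → e ∈ E A
  component-closed {B} {A} ((VA⊆ , EA⊆) , con , maxA) {e} {v} e∈B v∼e v∈ =
    proj₂ (maxA A+e A+e⊑ con′ (p⊆p∪q (T ⁅ e ⁆) , p⊆p∪q ⁅ e ⁆)) e∈A+e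
    where
    A+e : Subgraph G
    A+e = record
      { V      = V A ∪ T ⁅ e ⁆
      ; E      = E A ∪ ⁅ e ⁆
      ; closed = λ f∈ v∼f → x∈p∪q⁺ ([ (λ f∈A → inj₁ (closed A f∈A v∼f))
                                     , (λ f∈e → inj₂ (∈-touched⁺ G ⁅ e ⁆ f∈e v∼f)) ]′
                                     (x∈p∪q⁻ (E A) ⁅ e ⁆ f∈))
      }

    e∈A+e : e ∈ E A+e
    e∈A+e = q⊆p∪q (E A) ⁅ e ⁆ (x∈⁅x⁆ e)

    A+e⊑ : A+e ⊑ (G ⟨ B ⟩)
    A+e⊑ = ∪-lub VA⊆ (T-mono (⁅⁆⊆ e∈B)) , ∪-lub EA⊆ (⁅⁆⊆ e∈B)

    cover : ∀ {u} → u ∈ V A+e → u ∈ V A ⊎ Incident G u e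
    cover u∈ with x∈p∪q⁻ (V A) (T ⁅ e ⁆) u∈
    ... | inj₁ u∈A = inj₁ u∈A
    ... | inj₂ u∈e = inj₂ (∈T⁅⁆⁻ u∈e)

    con′ : ConnectedSubgraph A+e
    con′ = connected-attach {A} {A+e} con
      (p⊆p∪q (T ⁅ e ⁆)) (p⊆p∪q ⁅ e ⁆) e∈A+e v∈ v∼e cover

  -- Dense and tight sets

  -- The `k` here is the `j` used for bases, so density for `suc k` becomes a strict inequality, and
  -- strictness already forces `X` to be nonempty.
  excess⇒dense : ∀ {k X} → t X + k < ∣ X ∣ → Dense (suc k) G X
  excess⇒dense {k} {X} lt = 1≤∣p∣⇒Nonempty (≤-trans (s≤s z≤n) lt) ,
    subst (_≤ ∣ X ∣) (sym (+-suc (t X) k)) lt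

  dense⇒excess : ∀ {k X} → Dense (suc k) G X → t X + k < ∣ X ∣
  dense⇒excess {k} {X} (_ , le) = subst (_≤ ∣ X ∣) (+-suc (t X) k) le

  other-end : ∀ {v e} → Incident G v e → ∃[ w ] (∀ {u} → Incident G u e → u ≡ v ⊎ u ≡ w)
  other-end {e = e} (inj₁ refl) = proj₂ (ends G e) , λ u∼e → u∼e
  other-end {e = e} (inj₂ refl) = proj₁ (ends G e) , λ { (inj₁ eq) → inj₂ eq ; (inj₂ eq) → inj₁ eq }

  -- The set gains one edge and at most one vertex, the end of `e` other than `v`.
  dense-attach : ∀ {k X e v} → Dense k G X → e ∉ X → v ∈ T X → Incident G v e →
                 Dense k G (X ∪ ⁅ e ⁆)
  dense-attach {k} {X} {e} {v} ((x , x∈) , le) e∉X v∈ v∼e =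
    (x , p⊆p∪q ⁅ e ⁆ x∈) , (begin
      t (X ∪ ⁅ e ⁆) + k ≤⟨ +-monoˡ-≤ k t≤ ⟩
      suc (t X) + k     ≤⟨ s≤s le ⟩
      suc ∣ X ∣         ≤⟨ p⊂q⇒∣p∣<∣q∣ (⊂-∪⁅⁆ e∉X) ⟩
      ∣ X ∪ ⁅ e ⁆ ∣     ∎)
    where
    open ≤-Reasoning
    w : Fin (#V G)
    w = proj₁ (other-end v∼e)

    T⊆ : T (X ∪ ⁅ e ⁆) ⊆ T X ∪ ⁅ w ⁆
    T⊆ u∈ with x∈p∪q⁻ (T X) (T ⁅ e ⁆) (touched-∪ 0 G X ⁅ e ⁆ u∈)
    ... | inj₁ u∈X = p⊆p∪q ⁅ w ⁆ u∈X
    ... | inj₂ u∈e with proj₂ (other-end v∼e) (∈T⁅⁆⁻ u∈e)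
    ...   | inj₁ refl = p⊆p∪q ⁅ w ⁆ v∈
    ...   | inj₂ refl = q⊆p∪q (T X) ⁅ w ⁆ (x∈⁅x⁆ w)

    t≤ : t (X ∪ ⁅ e ⁆) ≤ suc (t X)
    t≤ = begin
      t (X ∪ ⁅ e ⁆)       ≤⟨ p⊆q⇒∣p∣≤∣q∣ T⊆ ⟩
      ∣ T X ∪ ⁅ w ⁆ ∣     ≤⟨ ∣∪∣≤∣∣+∣∣ (T X) ⁅ w ⁆ ⟩
      t X + ∣ ⁅ w ⁆ ∣     ≡⟨ cong (λ s → t X + s) (∣⁅x⁆∣≡1 w) ⟩
      t X + 1             ≡⟨ +-comm (t X) 1 ⟩
      suc (t X)           ∎

  -- As `t` is subadditive, adding `Y` costs at most `t Y` vertices and gains `∣ Y ∣` edges.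
  dense-∪-disjoint : ∀ {k X Y} → Dense k G X → t Y ≤ ∣ Y ∣ → (∀ {e} → e ∈ X → e ∉ Y) →
                     Dense k G (X ∪ Y)
  dense-∪-disjoint {k} {X} {Y} ((x , x∈) , le) tY≤ X#Y = (x , p⊆p∪q Y x∈) , (begin
      t (X ∪ Y) + k      ≤⟨ +-monoˡ-≤ k (t-∪ X Y) ⟩
      t X + t Y + k      ≡⟨ rearrange (t X) (t Y) k ⟩
      (t X + k) + t Y    ≤⟨ +-mono-≤ le tY≤ ⟩
      ∣ X ∣ + ∣ Y ∣      ≡⟨ disjoint⇒∣∪∣≡∣∣+∣∣ X#Y ⟨
      ∣ X ∪ Y ∣          ∎)
    where
    open ≤-Reasoning
    rearrange : ∀ a b c → a + b + c ≡ (a + c) + b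
    rearrange = solve-∀

  -- A dense set missing part of `B` can be enlarged: by an edge meeting it or, if it is closed, by
  -- the whole component of a missing edge. The growth ends only at `B`.
  dense-noTree : ∀ {k B C} → NoTreeComponent (G ⟨ B ⟩) → C ⊆ B → Dense k G C → Dense k G B
  dense-noTree {k} {B} {C} noTree C⊆B dC =
    let Z , (Z⊆B , dZ) , B⊆Z = ascend step C (C⊆B , dC)
    in subst (Dense k G) (⊆-antisym Z⊆B B⊆Z) dZ
    where
    P : Subset (#E G) → Set
    P X = X ⊆ B × Dense k G X

    step : ∀ X → P X → B ⊆ X ⊎ ∃[ Y ] (X ⊂ Y × P Y)
    step X (X⊆B , dX) with ⊆-or-witness B X | closed-or-attached B X
    ... | inj₁ B⊆X | _ = inj₁ B⊆X
    ... | inj₂ _   | inj₂ (e , e∈B , e∉X , v , v∈ , v∼e) = inj₂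
      (X ∪ ⁅ e ⁆ , ⊂-∪⁅⁆ e∉X , ∪-lub X⊆B (⁅⁆⊆ e∈B) , dense-attach dX e∉X v∈ v∼e)
    ... | inj₂ (e , e∈B , e∉X) | inj₁ closedX =
      let Y , e∈Y , Y⊆B , component@(_ , (_ , walk) , _) = component-of-edge e∈B
          -- A common edge `f` would start a walk in `Y` that stays in `T X` and reaches an end of
          -- `e`, forcing `e` into `X`.
          X#Y : ∀ {f} → f ∈ X → f ∉ Y
          X#Y f∈X f∈Y = e∉X (closedX e∈B (inj₁ refl)
            (walk-closed {G ⟨ Y ⟩} closedX Y⊆B
              (walk (∈-touched⁺ G Y f∈Y (inj₁ refl)) (∈-touched⁺ G Y e∈Y (inj₁ refl)))
              (∈-touched⁺ G X f∈X (inj₁ refl))))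
      in inj₂ (X ∪ Y , (p⊆p∪q Y , e , q⊆p∪q X Y e∈Y , e∉X) , ∪-lub X⊆B Y⊆B ,
               dense-∪-disjoint dX (ℤ.drop‿+≤+ (ℤ.0≤i-j⇒j≤i (noTree (G ⟨ Y ⟩) component))) X#Y)

  -- If `A` had fewer edges than vertices, the rest `R` of `B` would have more than `t R + j` edges.
  sparse-noTree : ∀ {j B} → (∀ {X} → X ⊆ B → ∣ X ∣ ≤ t X + j) → t B + j ≤ ∣ B ∣ →
                  NoTreeComponent (G ⟨ B ⟩)
  sparse-noTree {j} {B} sparse tight A component@((VA⊆ , _) , _) =
    ℤ.i≤j⇒0≤j-i (ℤ.+≤+ (+-cancelˡ-≤ (t R + j) _ _ total))
    where
    open ≤-Reasoning
    R : Subset (#E G)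
    R = B ∩ ∁ (E A)

    -- An edge of `B` at a vertex of the component belongs to the component, so `R` and `A` share no
    -- vertex and their vertex counts add up.
    TR#VA : ∀ {v} → v ∈ T R → v ∉ V A
    TR#VA v∈R v∈A with ∈-touched⁻ G R v∈R
    ... | e , e∈R , v∼e =
      let e∈B , e∈∁A = x∈p∩q⁻ B (∁ (E A)) e∈R
      in x∈∁p⇒x∉p e∈∁A (component-closed {B} {A} component e∈B v∼e v∈A)

    rearrange₁ : ∀ a b c → (a + b) + c ≡ (a + c) + b
    rearrange₁ = solve-∀

    total : (t R + j) + ∣ V A ∣ ≤ (t R + j) + ∣ E A ∣
    total = begin
      (t R + j) + ∣ V A ∣     ≡⟨ rearrange₁ (t R) j ∣ V A ∣ ⟩
      (t R + ∣ V A ∣) + j     ≡⟨ cong (λ s → s + j) (disjoint⇒∣∪∣≡∣∣+∣∣ TR#VA) ⟨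
      ∣ T R ∪ V A ∣ + j       ≤⟨ +-monoˡ-≤ j (p⊆q⇒∣p∣≤∣q∣ (∪-lub (T-mono (p∩q⊆p B _)) VA⊆)) ⟩
      t B + j                 ≤⟨ tight ⟩
      ∣ B ∣                   ≤⟨ ∣p∣≤∣p∩q∣+∣p∩∁q∣ B (E A) ⟩
      ∣ B ∩ E A ∣ + ∣ R ∣     ≤⟨ +-mono-≤ (∣p∩q∣≤∣q∣ B (E A)) (sparse (p∩q⊆p B _)) ⟩
      ∣ E A ∣ + (t R + j)     ≡⟨ +-comm ∣ E A ∣ _ ⟩
      (t R + j) + ∣ E A ∣     ∎

  -- Bases

  module _ {j : ℕ} {B : Subset (#E G)} where

    -- A subset violating the bound would be dense and so contain a circuit.
    independent⇒sparse : Independent (M (suc j) G) B → ∀ {X} → X ⊆ B → ∣ X ∣ ≤ t X + j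
    independent⇒sparse ind {X} X⊆B = ≮⇒≥ λ lt →
      let C , circuit , C⊆X = dense⇒circuit (suc j) G X (excess⇒dense lt)
      in ind C circuit λ x∈ → X⊆B (C⊆X x∈)

    tight-∪ : (∀ {X} → X ⊆ B → ∣ X ∣ ≤ t X + j) → ∀ {X Y} → X ⊆ B →
              t X + j ≤ ∣ X ∣ → t Y + j ≤ ∣ Y ∣ → t (X ∪ Y) + j ≤ ∣ X ∪ Y ∣
    tight-∪ sparse {X} {Y} X⊆B tightX tightY = +-cancelʳ-≤ (t (X ∩ Y) + j) _ _ (begin
      (t (X ∪ Y) + j) + (t (X ∩ Y) + j)   ≡⟨ rearrange (t (X ∪ Y)) (t (X ∩ Y)) j ⟩
      (t (X ∪ Y) + t (X ∩ Y)) + (j + j)   ≤⟨ +-monoˡ-≤ (j + j) (t-submodular X Y) ⟩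
      (t X + t Y) + (j + j)               ≡⟨ rearrange (t X) (t Y) j ⟨
      (t X + j) + (t Y + j)               ≤⟨ +-mono-≤ tightX tightY ⟩
      ∣ X ∣ + ∣ Y ∣                       ≡⟨ ∣∪∣+∣∩∣ X Y ⟨
      -- The intersection may be empty; the bound then holds because `j` is nonnegative.
      ∣ X ∪ Y ∣ + ∣ X ∩ Y ∣               ≤⟨ +-monoʳ-≤ ∣ X ∪ Y ∣ (sparse λ x∈ → X⊆B (p∩q⊆p X Y x∈)) ⟩
      ∣ X ∪ Y ∣ + (t (X ∩ Y) + j)         ∎)
      where
      open ≤-Reasoning
      rearrange : ∀ a b c → (a + c) + (b + c) ≡ (a + b) + (c + c)
      rearrange = solve-∀

    -- A dense `D` in `B ∪ ⁅ e ⁆` plays the part of the fundamental circuit and exists because `B`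
    -- is maximal. It must contain `e`, and `D ∩ B`, only one edge smaller, is tight.
    base-spans : Base (M (suc j) G) B → ∀ {e} → e ∉ B →
      ∃[ Y ] (Y ⊆ B × t Y + j ≤ ∣ Y ∣ × (∀ {v} → Incident G v e → v ∈ T Y))
    base-spans (ind , maxB) {e} e∉B
      with anySubset? (λ D → (D ⊆? B ∪ ⁅ e ⁆) ×-dec dense? (suc j) G D)
    ... | no ¬dense = ⊥-elim (e∉B (subst (e ∈_) B+e≡B (q⊆p∪q B ⁅ e ⁆ (x∈⁅x⁆ e))))
      where
      B+e≡B : B ∪ ⁅ e ⁆ ≡ B
      B+e≡B = maxB (B ∪ ⁅ e ⁆)
        (λ C circuit C⊆ → ¬dense (C , C⊆ , candidate⇒dense (suc j) G (proj₁ circuit)))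
        (p⊆p∪q ⁅ e ⁆)
    -- By `tD≤` the nested sets `T (D ∩ B)` and `T D` coincide, so `D ∩ B` touches the ends of `e`.
    ... | yes (D , D⊆ , dD) = D ∩ B , p∩q⊆q D B , tight , λ v∼e →
      p⊆q∧∣q∣≤∣p∣⇒q⊆p (T-mono (p∩q⊆p D B)) tD≤ (∈-touched⁺ G D e∈D v∼e)
      where
      open ≤-Reasoning
      sparse : ∀ {X} → X ⊆ B → ∣ X ∣ ≤ t X + j
      sparse = independent⇒sparse ind

      e∈D : e ∈ D
      e∈D with e ∈? D
      ... | yes e∈ = e∈
      ... | no  e∉ = ⊥-elim (<⇒≱ (dense⇒excess dD) (sparse (⊆∪⁅⁆∖ D⊆ e∉)))

      D⊆D∩B+e : D ⊆ (D ∩ B) ∪ ⁅ e ⁆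
      D⊆D∩B+e x∈D with x∈p∪q⁻ B ⁅ e ⁆ (D⊆ x∈D)
      ... | inj₁ x∈B = p⊆p∪q ⁅ e ⁆ (x∈p∩q⁺ (x∈D , x∈B))
      ... | inj₂ x∈e = q⊆p∪q (D ∩ B) ⁅ e ⁆ x∈e

      bound : t D + j ≤ ∣ D ∩ B ∣
      bound = s≤s⁻¹ (begin
        suc (t D + j)             ≤⟨ dense⇒excess dD ⟩
        ∣ D ∣                     ≤⟨ p⊆q⇒∣p∣≤∣q∣ D⊆D∩B+e ⟩
        ∣ (D ∩ B) ∪ ⁅ e ⁆ ∣       ≤⟨ ∣∪∣≤∣∣+∣∣ (D ∩ B) ⁅ e ⁆ ⟩
        ∣ D ∩ B ∣ + ∣ ⁅ e ⁆ ∣     ≡⟨ cong (λ s → ∣ D ∩ B ∣ + s) (∣⁅x⁆∣≡1 e) ⟩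
        ∣ D ∩ B ∣ + 1             ≡⟨ +-comm _ 1 ⟩
        suc ∣ D ∩ B ∣             ∎)

      tight : t (D ∩ B) + j ≤ ∣ D ∩ B ∣
      tight = ≤-trans (+-monoˡ-≤ j (t-mono (p∩q⊆p D B))) bound

      tD≤ : t D ≤ t (D ∩ B)
      tD≤ = +-cancelʳ-≤ j _ _ (≤-trans bound (sparse (p∩q⊆q D B)))

    -- Here S ∩ D has more excess than D because adding D ∖ S to the tight set Z,
    -- which touches all of T S, strictly lowers the excess.
    spanning-absorbs : ∀ {S Z D} → Z ⊆ S → T S ⊆ T Z → t Z + j ≤ ∣ Z ∣ →
      ∣ Z ∪ (D ∩ ∁ S) ∣ < t (Z ∪ (D ∩ ∁ S)) + j →
      Dense (suc j) G D → Dense (suc j) G (S ∩ D)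
    spanning-absorbs {S} {Z} {D} Z⊆S TS⊆ tightZ loose dD =
      excess⇒dense (+-cancelʳ-≤ (∣ D′ ∣ + (t Z + j)) _ _ (begin
        suc (t (S ∩ D) + j) + (∣ D′ ∣ + (t Z + j))   ≤⟨ +-monoʳ-≤ (suc (t (S ∩ D) + j)) D′+Z≤ ⟩
        suc (t (S ∩ D) + j) + ∣ Z ∪ D′ ∣             ≡⟨ +-suc (t (S ∩ D) + j) _ ⟨
        (t (S ∩ D) + j) + suc ∣ Z ∪ D′ ∣             ≤⟨ +-monoʳ-≤ (t (S ∩ D) + j) loose ⟩
        (t (S ∩ D) + j) + (t (Z ∪ D′) + j)           ≤⟨ +-monoʳ-≤ (t (S ∩ D) + j) (+-monoˡ-≤ j (t-mono Z∪D′⊆)) ⟩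
        (t (S ∩ D) + j) + (t (S ∪ D) + j)            ≡⟨ rearrange₁ (t (S ∩ D)) (t (S ∪ D)) j ⟩
        (t (S ∪ D) + t (S ∩ D)) + (j + j)            ≤⟨ +-monoˡ-≤ (j + j) (t-submodular S D) ⟩
        (t S + t D) + (j + j)                        ≤⟨ +-monoˡ-≤ (j + j) (+-monoˡ-≤ (t D) (p⊆q⇒∣p∣≤∣q∣ TS⊆)) ⟩
        (t Z + t D) + (j + j)                        ≡⟨ rearrange₂ (t Z) (t D) j ⟩
        (t D + j) + (t Z + j)                        ≤⟨ +-monoˡ-≤ (t Z + j) (<⇒≤ (dense⇒excess dD)) ⟩
        ∣ D ∣ + (t Z + j)                            ≤⟨ +-monoˡ-≤ (t Z + j) (∣p∣≤∣p∩q∣+∣p∩∁q∣ D S) ⟩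
        (∣ D ∩ S ∣ + ∣ D′ ∣) + (t Z + j)             ≡⟨ cong (λ Y → (∣ Y ∣ + ∣ D′ ∣) + (t Z + j)) (∩-comm D S) ⟩
        (∣ S ∩ D ∣ + ∣ D′ ∣) + (t Z + j)             ≡⟨ +-assoc ∣ S ∩ D ∣ _ _ ⟩
        ∣ S ∩ D ∣ + (∣ D′ ∣ + (t Z + j))             ∎))
      where
      open ≤-Reasoning
      D′ : Subset (#E G)
      D′ = D ∩ ∁ S

      Z#D′ : ∀ {x} → x ∈ Z → x ∉ D′
      Z#D′ x∈Z x∈D′ = x∈∁p⇒x∉p (p∩q⊆q D (∁ S) x∈D′) (Z⊆S x∈Z)

      D′+Z≤ : ∣ D′ ∣ + (t Z + j) ≤ ∣ Z ∪ D′ ∣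
      D′+Z≤ = begin
        ∣ D′ ∣ + (t Z + j)   ≤⟨ +-monoʳ-≤ ∣ D′ ∣ tightZ ⟩
        ∣ D′ ∣ + ∣ Z ∣       ≡⟨ +-comm ∣ D′ ∣ _ ⟩
        ∣ Z ∣ + ∣ D′ ∣       ≡⟨ disjoint⇒∣∪∣≡∣∣+∣∣ Z#D′ ⟨
        ∣ Z ∪ D′ ∣           ∎

      Z∪D′⊆ : Z ∪ D′ ⊆ S ∪ D
      Z∪D′⊆ = ∪-lub (λ x∈ → p⊆p∪q D (Z⊆S x∈)) (λ x∈ → q⊆p∪q S D (p∩q⊆p D (∁ S) x∈))

      rearrange₁ : ∀ a b c → (a + c) + (b + c) ≡ (b + a) + (c + c)
      rearrange₁ = solve-∀

      rearrange₂ : ∀ a b c → (a + b) + (c + c) ≡ (b + c) + (a + c)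
      rearrange₂ = solve-∀

    -- Two distinct elements exist and lie on a common circuit, which the independent set `B` cannot
    -- contain.
    connected⇒∃∉ : Connected (M (suc j) G) → Independent (M (suc j) G) B → ∃[ e ] (e ∉ B)
    connected⇒∃∉ (2≤ , joined) ind with two 2≤
      where
      two : ∀ {m} → 2 ≤ m → ∃[ x ] ∃[ y ] (_≢_ {A = Fin m} x y)
      two (s≤s (s≤s _)) = Fin.zero , Fin.suc Fin.zero , λ ()
    ... | x , y , x≢y with joined x y x≢y
    ...   | C , circuit , _ with ⊆-or-witness C B
    ...     | inj₁ C⊆B           = ⊥-elim (ind C circuit C⊆B)
    ...     | inj₂ (e , _ , e∉B) = e , e∉B

    largest-tight⊇base : Connected (M (suc j) G) → ∀ {Z e₀} → e₀ ∉ B →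
      Z ⊆ B → t Z + j ≤ ∣ Z ∣ → (∀ {Y} → Y ⊆ B → t Y + j ≤ ∣ Y ∣ → Y ⊆ Z) →
      (∀ {e v} → e ∉ B → Incident G v e → v ∈ T Z) → B ⊆ Z
    largest-tight⊇base (_ , joined) {Z} {e₀} e₀∉B Z⊆B tightZ tight⇒⊆Z Z-spans = B⊆Z
      where
      S : Subset (#E G)
      -- The complement of `S` is the part of `B` outside `Z`, while `S` touches no vertex beyond
      -- `T Z`. Removing `D ∩ ∁ S` from a circuit `D` therefore removes only elements of `B` outside
      -- `Z`.
      S = Z ∪ ∁ B

      TS⊆TZ : T S ⊆ T Z
      TS⊆TZ v∈ with ∈-touched⁻ G S v∈
      ... | e , e∈S , v∼e with x∈p∪q⁻ Z (∁ B) e∈S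
      ...   | inj₁ e∈Z  = ∈-touched⁺ G Z e∈Z v∼e
      ...   | inj₂ e∈∁B = Z-spans (x∈∁p⇒x∉p e∈∁B) v∼e

      B⊆Z : B ⊆ Z
      B⊆Z {g} g∈B with g ∈? Z
      ... | yes g∈Z = g∈Z
      ... | no  g∉Z with joined g e₀ (λ eq → e₀∉B (subst (_∈ B) eq g∈B))
      ...   | D , circuit@(candD , _) , g∈D , _ = ⊥-elim (g∉S (p∩q⊆p S D (subst (g ∈_) D≡ g∈D)))
        where
        g∉S : g ∉ S
        g∉S g∈S with x∈p∪q⁻ Z (∁ B) g∈S
        ... | inj₁ g∈Z  = g∉Z g∈Z
        ... | inj₂ g∈∁B = x∈∁p⇒x∉p g∈∁B g∈B

        Z∪D′⊆B : Z ∪ (D ∩ ∁ S) ⊆ B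
        Z∪D′⊆B = ∪-lub Z⊆B λ x∈ →
          x∉∁p⇒x∈p λ x∈∁B → x∈∁p⇒x∉p (p∩q⊆q D (∁ S) x∈) (q⊆p∪q Z (∁ B) x∈∁B)

        -- A tight `Z ∪ (D ∩ ∁ S)` would be part of `Z`, yet it contains `g`.
        loose : ∣ Z ∪ (D ∩ ∁ S) ∣ < t (Z ∪ (D ∩ ∁ S)) + j
        loose = ≰⇒> λ tight → g∉Z (tight⇒⊆Z Z∪D′⊆B tight
          (q⊆p∪q Z (D ∩ ∁ S) (x∈p∩q⁺ (g∈D , x∉p⇒x∈∁p g∉S))))

        -- The dense set `S ∩ D` contains a circuit, which minimality identifies with `D`; this puts
        -- `g` into `S`.
        D≡ : D ≡ S ∩ D
        D≡ =
          let C , circuitC , C⊆ = dense⇒circuit (suc j) G (S ∩ D)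
                (spanning-absorbs (p⊆p∪q (∁ B)) TS⊆TZ tightZ loose
                  (candidate⇒dense (suc j) G candD))
              C≡D = circuit-clutter (suc j) G circuitC circuit (λ x∈ → p∩q⊆q S D (C⊆ x∈))
          in ⊆-antisym (subst (_⊆ S ∩ D) C≡D C⊆) (p∩q⊆q S D)

    base⇒tight-spanning : Connected (M (suc j) G) → Base (M (suc j) G) B →
                          t B + j ≤ ∣ B ∣ × T B ≡ ⊤
    base⇒tight-spanning conn base@(ind , _)
      with connected⇒∃∉ conn ind
    -- An element outside `B` provides the first tight set to enlarge; the empty set is tight only
    -- when `j` is 0.
    ... | e₀ , e₀∉B with base-spans base e₀∉B
    ...   | Y₀ , Y₀⊆B , tightY₀ , _
      with maximal (λ X → (X ⊆? B) ×-dec (t X + j ≤? ∣ X ∣)) Y₀ (Y₀⊆B , tightY₀)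
    ...     | Z , (Z⊆B , tightZ) , maxZ =
      subst (λ X → t X + j ≤ ∣ X ∣) (⊆-antisym Z⊆B B⊆Z) tightZ ,
      ⊆-antisym ⊆⊤ λ {v} _ → TB-full v (noIsolated G v)
      where
      -- Unions of tight sets are tight, so the maximal `Z` is the largest tight subset of `B`.
      tight⇒⊆Z : ∀ {Y} → Y ⊆ B → t Y + j ≤ ∣ Y ∣ → Y ⊆ Z
      tight⇒⊆Z {Y} Y⊆B tightY y∈ = maxZ (Z ∪ Y)
        (∪-lub Z⊆B Y⊆B , tight-∪ (independent⇒sparse ind) Z⊆B tightZ tightY)
        (p⊆p∪q Y) (q⊆p∪q Z Y y∈)

      Z-spans : ∀ {e v} → e ∉ B → Incident G v e → v ∈ T Z
      Z-spans e∉B v∼e =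
        let _ , Y⊆B , tightY , ends∈ = base-spans base e∉B
        in T-mono (tight⇒⊆Z Y⊆B tightY) (ends∈ v∼e)

      B⊆Z : B ⊆ Z
      B⊆Z = largest-tight⊇base conn e₀∉B Z⊆B tightZ tight⇒⊆Z Z-spans

      TB-full : ∀ v → ∃[ e ] Incident G v e → v ∈ T B
      TB-full v (e , v∼e) with e ∈? B
      ... | yes e∈B = ∈-touched⁺ G B e∈B v∼e
      ... | no  e∉B = T-mono Z⊆B (Z-spans e∉B v∼e)

    -- A dense subset would make `B` itself dense, against its size. For maximality, `B` already
    -- touches every vertex, so a proper superset gains only edges and becomes dense.
    noTree⇒base : ∣ B ∣ ≡ t B + j → T B ≡ ⊤ → NoTreeComponent (G ⟨ B ⟩) → Base (M (suc j) G) B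
    noTree⇒base size full noTree = ind , maxB
      where
      open ≤-Reasoning
      ind : Independent (M (suc j) G) B
      ind C (candC , _) C⊆B = <⇒≱
        (dense⇒excess (dense-noTree noTree C⊆B (candidate⇒dense (suc j) G candC)))
        (≤-reflexive size)

      maxB : ∀ I → Independent (M (suc j) G) I → B ⊆ I → I ≡ B
      maxB I indI B⊆I with ⊆-or-witness I B
      ... | inj₁ I⊆B = ⊆-antisym I⊆B B⊆I
      ... | inj₂ w   =
        let C , circuit , C⊆I = dense⇒circuit (suc j) G I (excess⇒dense excess)
        in ⊥-elim (indI C circuit C⊆I)
        where
        excess : t I + j < ∣ I ∣
        excess = begin-strict
          t I + j           ≤⟨ +-monoˡ-≤ j (p⊆q⇒∣p∣≤∣q∣ (subst (T I ⊆_) (sym full) ⊆⊤)) ⟩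
          t B + j           ≡⟨ size ⟨
          ∣ B ∣             <⟨ p⊂q⇒∣p∣<∣q∣ (B⊆I , w) ⟩
          ∣ I ∣             ∎

-- Opened only here because a prefix +_ makes sums of cardinalities ∣_∣ ambiguous.
open import Data.Integer using (+_; 1ℤ; _-_)

-- Integer differences of naturals

m≡n+o⇒+m-+n≡+o : ∀ {m n o} → m ≡ n + o → + m - + n ≡ + o
m≡n+o⇒+m-+n≡+o {n = n} {o} refl = trans (ℤ.[+m]-[+n]≡m⊖n (n + o) n)
  (trans (ℤ.⊖-≥ (m≤m+n n o)) (cong +_ (m+n∸m≡n n o)))

+m-+n≡+o⇒m≡n+o : ∀ {m n o} → + m - + n ≡ + o → m ≡ n + o
+m-+n≡+o⇒m≡n+o {m} {n} {o} eq = ℤ.+-injective (begin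
  + m                          ≡⟨ ℤ.+-identityʳ (+ m) ⟨
  + m ℤ.+ ℤ.0ℤ                 ≡⟨ cong (λ i → + m ℤ.+ i) (ℤ.+-inverseˡ (+ n)) ⟨
  + m ℤ.+ (ℤ.- + n ℤ.+ + n)    ≡⟨ ℤ.+-assoc (+ m) (ℤ.- + n) (+ n) ⟨
  (+ m - + n) ℤ.+ + n          ≡⟨ cong (λ i → i ℤ.+ + n) eq ⟩
  + (o + n)                    ≡⟨ cong +_ (+-comm o n) ⟩
  + (n + o)                    ∎)
  where open ≡-Reasoning

mainTheorem16 : (G : Graph) (k : ℕ) → 1 ≤ k → Connected (M k G) →
    (B : Subset (#E G)) →
    Base (M k G) B ⇔ (Δ (G ⟨ B ⟩) ≡ + k - 1ℤ × V (G ⟨ B ⟩) ≡ ⊤ × NoTreeComponent (G ⟨ B ⟩))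
mainTheorem16 G (suc j) _ conn B = mk⇔
  -- As `k` is `suc j`, the integer `+ k - 1ℤ` computes to `+ j`. Sparsity of `B` itself bounds its
  -- size from above, tightness from below.
  (λ base →
    let tight , full = base⇒tight-spanning G conn base
        sparse : ∀ {X} → X ⊆ B → ∣ X ∣ ≤ ∣ touched G X ∣ + j
        sparse = independent⇒sparse G (proj₁ base)
    in m≡n+o⇒+m-+n≡+o (≤-antisym (sparse (λ x∈ → x∈)) tight) , full , sparse-noTree G sparse tight)
  (λ (size , full , noTree) → noTree⇒base G (+m-+n≡+o⇒m≡n+o size) full noTree)
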